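{- Let $d\in\mathbb{N}$. Then $$\mathrm{WA} = \pi(\Pi) \qquad\text{and hence}\qquad \mathrm{Bad} = \mathbb{R}^d\setminus \pi(\Pi).$$
   Context: For $z\in\mathbb{R}^d$, $\|z\|$ denotes the sup-norm distance from $z$ to $\mathbb{Z}^d$. Write $\mathbb{N}=\{1,2,3,\dots\}$. $\mathrm{Bad}=\{x\in\mathbb{R}^d : \inf_{n\in\mathbb{N}} n\|nx\|^d>0\}$ is the set of badly approximable vectors, and $\mathrm{WA}=\mathbb{R}^d\setminus\mathrm{Bad}$. For $\psi:\mathbb{N}\to\mathbb{R}_{\ge 0}$, let $W(\psi)$ be the set of pairs $(x,y)\in\mathbb{R}^d\times\mathbb{R}^d$ for which $\|nx+y\|<\psi(n)$ holds for infinitely many $n\in\mathbb{N}$. $\mathcal{D}$ is the set of all non-increasing $\psi:\mathbb{N}\to\mathbb{R}_{\ge0}$ such that $\sum_n\psi(n)^d$ diverges, and $\Pi=\bigcap_{\psi\in\mathcal{D}}W(\psi)$. $\pi:\mathbb{R}^d\times\mathbb{R}^d\to\mathbb{R}^d$ is the projection $\pi(x,y)=x$. -}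

module Defs where

open import Algebra.Bundles using (CommutativeRing; Semiring)
import Algebra.Construct.NaturalChoice.Max as Max
import Algebra.Definitions.RawSemiring as RawSemiringDefs
open import Data.Integer.Base using (ℤ; +_; -[1+_])
open import Data.Nat.Base as ℕ using (ℕ; zero; suc; NonZero)
open import Data.Product.Base using (Σ; ∃; _×_; _,_; proj₁; proj₂)
open import Data.Sum.Base using (inj₁; inj₂)
open import Data.Vec.Functional using (Vector; foldr; map; zipWith)
import Data.Vec.Functional.Relation.Binary.Equality.Setoid as VecEquality
open import Level using (0ℓ) renaming (suc to lsuc)
open import Relation.Binary.Bundles using (TotalOrder)
open import Relation.Binary.Core using (Rel)
import Relation.Binary.Construct.NonStrictToStrict as ToStrict
open import Relation.Binary.Structures using (IsTotalOrder)
open import Relation.Nullary.Negation.Core using (¬_)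
open import Relation.Unary using (Pred; _∈_; ∁; ⋂; Satisfiable)

module _ {A : Set} (_≤_ : Rel A 0ℓ) where

  IsUpperBound : Pred A 0ℓ → Pred A 0ℓ
  IsUpperBound P b = ∀ x → x ∈ P → x ≤ b

  IsSupremum : Pred A 0ℓ → Pred A 0ℓ
  IsSupremum P s = s ∈ IsUpperBound P × (∀ b → b ∈ IsUpperBound P → s ≤ b)

-- The axioms of the field of real numbers.  Classically these determine ℝ up
-- to a unique isomorphism, so ranging over all models amounts to fixing ℝ.

record CompleteOrderedField : Set (lsuc 0ℓ) where
  field
    commutativeRing : CommutativeRing 0ℓ 0ℓ

  open CommutativeRing commutativeRing public

  infix 4 _≤_

  field
    0≉1          : ¬ (0# ≈ 1#)
    inverse      : ∀ x → ¬ (x ≈ 0#) → ∃ λ y → x * y ≈ 1#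
    _≤_          : Rel Carrier 0ℓ
    isTotalOrder : IsTotalOrder _≈_ _≤_
    +-monoˡ-≤    : ∀ z {x y} → x ≤ y → x + z ≤ y + z
    *-nonNeg     : ∀ {x y} → 0# ≤ x → 0# ≤ y → 0# ≤ x * y
    supremum     : (P : Pred Carrier 0ℓ) → Satisfiable P →
                   Satisfiable (IsUpperBound _≤_ P) →
                   Satisfiable (IsSupremum _≤_ P)

  totalOrder : TotalOrder 0ℓ 0ℓ 0ℓ
  totalOrder = record { isTotalOrder = isTotalOrder }

  open TotalOrder totalOrder public using ()
    renaming ( refl to ≤-refl; trans to ≤-trans; total to ≤-total
             ; reflexive to ≤-reflexive; antisym to ≤-antisym
             ; ≤-respʳ-≈ to ≤-respʳ-≈; ≤-respˡ-≈ to ≤-respˡ-≈ )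

  open ToStrict _≈_ _≤_ public using (_<_)
  open Max totalOrder public using (_⊔_; x≤x⊔y; x≤y⊔x)

  open RawSemiringDefs (Semiring.rawSemiring semiring) public using (_^_) renaming (_×_ to _·_)

  ∣_∣ : Carrier → Carrier
  ∣ x ∣ = x ⊔ (- x)

  fromℤ : ℤ → Carrier
  fromℤ (+ n)    = n · 1#
  fromℤ -[1+ n ] = - (suc n · 1#)

  -- The infimum of a family is the supremum of its lower bounds.

  IsLowerBoundOf : {I : Set} → (I → Carrier) → Pred Carrier 0ℓ
  IsLowerBoundOf f b = ∀ i → b ≤ f i

  module _ {I : Set} (f : I → Carrier) (i₀ : I)
           (bounded : Satisfiable (IsLowerBoundOf f)) where

    private
      sup : Satisfiable (IsSupremum _≤_ (IsLowerBoundOf f))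
      sup = supremum (IsLowerBoundOf f) bounded (f i₀ , λ b b≤f → b≤f i₀)

    inf : Carrier
    inf = proj₁ sup

    inf-lower : inf ∈ IsLowerBoundOf f
    inf-lower i = proj₂ (proj₂ sup) (f i) (λ b b≤f → b≤f i)

    inf-greatest : ∀ b → b ∈ IsLowerBoundOf f → b ≤ inf
    inf-greatest = proj₁ (proj₂ sup)

  +-nonNeg : ∀ {x y} → 0# ≤ x → 0# ≤ y → 0# ≤ x + y
  +-nonNeg {x} {y} 0≤x 0≤y =
    ≤-trans 0≤y (≤-respˡ-≈ (+-identityˡ y) (+-monoˡ-≤ y 0≤x))

  0≤∣x∣ : ∀ x → 0# ≤ ∣ x ∣
  0≤∣x∣ x with ≤-total 0# x
  ... | inj₁ 0≤x = ≤-trans 0≤x (x≤x⊔y x (- x))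
  ... | inj₂ x≤0 = ≤-trans 0≤-x (x≤y⊔x x (- x))
    where
    0≤-x : 0# ≤ - x
    0≤-x = ≤-respˡ-≈ (-‿inverseʳ x)
             (≤-respʳ-≈ (+-identityˡ (- x)) (+-monoˡ-≤ (- x) x≤0))

  0≤1 : 0# ≤ 1#
  0≤1 with ≤-total 0# 1#
  ... | inj₁ 0≤1 = 0≤1
  ... | inj₂ 1≤0 = ≤-respʳ-≈ -1*-1≈1 (*-nonNeg 0≤-1 0≤-1)
    where
    open import Algebra.Properties.Ring ring using (-1*x≈-x; -‿involutive)
    0≤-1 : 0# ≤ - 1#
    0≤-1 = ≤-respˡ-≈ (-‿inverseʳ 1#)
             (≤-respʳ-≈ (+-identityˡ (- 1#)) (+-monoˡ-≤ (- 1#) 1≤0))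
    -1*-1≈1 : - 1# * - 1# ≈ 1#
    -1*-1≈1 = trans (-1*x≈-x (- 1#)) (-‿involutive 1#)

  ·-nonNeg : ∀ n {x} → 0# ≤ x → 0# ≤ n · x
  ·-nonNeg zero    0≤x = ≤-refl
  ·-nonNeg (suc n) 0≤x = +-nonNeg 0≤x (·-nonNeg n 0≤x)

  ^-nonNeg : ∀ {x} n → 0# ≤ x → 0# ≤ x ^ n
  ^-nonNeg zero    0≤x = 0≤1
  ^-nonNeg (suc n) 0≤x = *-nonNeg 0≤x (^-nonNeg n 0≤x)

ℕ⁺ : Set
ℕ⁺ = Σ ℕ NonZero

toℕ : ℕ⁺ → ℕ
toℕ = proj₁

1⁺ : ℕ⁺
1⁺ = 1 , _

InfinitelyMany : Pred ℕ⁺ 0ℓ → Set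
InfinitelyMany P = ∀ N → ∃ λ n → N ℕ.≤ toℕ n × n ∈ P

module DiophantineApproximation (R : CompleteOrderedField) (d : ℕ) where

  open CompleteOrderedField R

  ℝ : Set
  ℝ = Carrier

  ℝᵈ : Set
  ℝᵈ = Vector ℝ d

  open VecEquality setoid public using (_≋_)

  infixl 6 _+ᵛ_ _-ᵛ_
  infixr 8 _·ᵛ_

  _+ᵛ_ : ℝᵈ → ℝᵈ → ℝᵈ
  _+ᵛ_ = zipWith _+_

  _-ᵛ_ : ℝᵈ → ℝᵈ → ℝᵈ
  _-ᵛ_ = zipWith _-_

  _·ᵛ_ : ℕ⁺ → ℝᵈ → ℝᵈ
  n ·ᵛ x = map (toℕ n ·_) x

  -- Absolute values are non-negative, so starting the fold at 0# does not
  -- change the maximum.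

  supNorm : ∀ {k} → Vector ℝ k → ℝ
  supNorm z = foldr _⊔_ 0# (map ∣_∣ z)

  0≤supNorm : ∀ {k} (z : Vector ℝ k) → 0# ≤ supNorm z
  0≤supNorm {zero}  z = ≤-refl
  0≤supNorm {suc k} z = ≤-trans (0≤∣x∣ _) (x≤x⊔y _ _)

  distance : ℝᵈ → Vector ℤ d → ℝ
  distance z m = supNorm (z -ᵛ map fromℤ m)

  0≤distance : ∀ z m → 0# ≤ distance z m
  0≤distance z m = 0≤supNorm (z -ᵛ map fromℤ m)

  ‖_‖ : ℝᵈ → ℝ
  ‖ z ‖ = inf (distance z) (λ _ → + 0) (0# , 0≤distance z)

  0≤‖z‖ : ∀ z → 0# ≤ ‖ z ‖
  0≤‖z‖ z = inf-greatest (distance z) _ _ 0# (0≤distance z)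

  quality : ℝᵈ → ℕ⁺ → ℝ
  quality x n = toℕ n · (‖ n ·ᵛ x ‖ ^ d)

  0≤quality : ∀ x n → 0# ≤ quality x n
  0≤quality x n = ·-nonNeg (toℕ n) (^-nonNeg d (0≤‖z‖ (n ·ᵛ x)))

  Bad : Pred ℝᵈ 0ℓ
  Bad x = 0# < inf (quality x) 1⁺ (0# , 0≤quality x)

  WA : Pred ℝᵈ 0ℓ
  WA = ∁ Bad

  W : (ℕ⁺ → ℝ) → Pred (ℝᵈ × ℝᵈ) 0ℓ
  W ψ (x , y) = InfinitelyMany λ n → ‖ n ·ᵛ x +ᵛ y ‖ < ψ n

  partialSum : (ℕ⁺ → ℝ) → ℕ → ℝ
  partialSum a zero    = 0#
  partialSum a (suc n) = partialSum a n + a (suc n , _)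

  ConvergesTo : (ℕ → ℝ) → Pred ℝ 0ℓ
  ConvergesTo s l =
    ∀ ε → 0# < ε → ∃ λ N → ∀ n → N ℕ.≤ n → ∣ s n - l ∣ < ε

  SeriesDiverges : Pred (ℕ⁺ → ℝ) 0ℓ
  SeriesDiverges a = ¬ Satisfiable (ConvergesTo (partialSum a))

  record 𝒟 (ψ : ℕ⁺ → ℝ) : Set where
    field
      nonNegative   : ∀ n → 0# ≤ ψ n
      nonIncreasing : ∀ m n → toℕ m ℕ.≤ toℕ n → ψ n ≤ ψ m
      divergent     : SeriesDiverges (λ n → ψ n ^ d)

  Π : Pred (ℝᵈ × ℝᵈ) 0ℓ
  Π = ⋂ (Σ (ℕ⁺ → ℝ) 𝒟) (λ ψ → W (proj₁ ψ))

  π : ℝᵈ × ℝᵈ → ℝᵈ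
  π = proj₁

  π[_] : Pred (ℝᵈ × ℝᵈ) 0ℓ → Pred ℝᵈ 0ℓ
  π[ S ] x = ∃ λ p → p ∈ S × π p ≋ x

{-# OPTIONS --safe #-}
module Submission where

-- If x is badly approximable then, for any y, let g(n) be the least positive
-- value among 1 and ‖ k x + y ‖ for k ≤ n.  Two consecutive record times m < m′
-- satisfy c ≤ (m′ − m) (2 g(m))ᵈ, so between them g(m)ᵈ sums to at least c / 2ᵈ
-- and the series of g(n)ᵈ diverges, while ‖ n x + y ‖ < g(n) happens at most once.
--
-- If x is well approximable, choose one after another qⱼ, integer vectors pⱼ and
-- εⱼ such that qⱼ x is within εⱼ₊₁ of pⱼ, 2 εⱼ₊₁ ≤ εⱼ and qⱼ (2 εⱼ₊₁)ᵈ ≤ εⱼ, and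
-- put y = − Σⱼ (qⱼ x − pⱼ).  With nⱼ = Σ_{k<j} q_k one gets ‖ nⱼ x + y ‖ ≤ 2 εⱼ₊₁.
-- A non-increasing ψ with ψ(n) ≤ ‖ n x + y ‖ for large n thus contributes at most
-- qⱼ (2 εⱼ₊₁)ᵈ ≤ εⱼ to Σ ψ(n)ᵈ on the block (nⱼ , nⱼ₊₁], so Σ ψ(n)ᵈ converges.

open import Defs
import Algebra.Construct.NaturalChoice.Max as Max
import Algebra.Properties.CommutativeSemiring.Exp as Exp
import Algebra.Properties.Ring as RingProperties
import Algebra.Properties.Semiring.Mult as Mult
import Algebra.Solver.Ring as RingSolver
open import Algebra.Solver.Ring.AlmostCommutativeRing
  using (fromCommutativeRing; _-Raw-AlmostCommutative⟶_)
open import Axiom.DoubleNegationElimination using (em⇒dne)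
open import Axiom.ExcludedMiddle using (ExcludedMiddle)
open import Data.Empty using (⊥; ⊥-elim)
open import Data.Fin.Base using (Fin; zero; suc)
open import Data.Integer.Base as ℤ using (ℤ; +_; -[1+_]; _⊖_; _◃_)
import Data.Integer.Properties as ℤ
import Data.Maybe.Base as Maybe
open import Data.Nat.Base as ℕ using (ℕ; zero; suc; NonZero; z≤n; s≤s)
import Data.Nat.Properties as ℕ
open import Data.Product.Base using (_×_; ∃; _,_; proj₁; proj₂)
open import Data.Sign.Base as Sign using (Sign)
open import Data.Sum.Base using (_⊎_; inj₁; inj₂; [_,_]′)
open import Data.Vec.Functional using (Vector; zipWith)
open import Level using (0ℓ)
open import Relation.Binary.Bundles using (TotalOrder)
import Relation.Binary.Construct.NonStrictToStrict as ToStrict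
import Relation.Binary.PropositionalEquality as ≡
open ≡ using (_≡_)
import Relation.Binary.Reasoning.PartialOrder as PartialOrderReasoning
import Relation.Binary.Reasoning.Setoid as SetoidReasoning
open import Relation.Nullary.Decidable.Core using (Dec; yes; no; dec⇒maybe)
open import Relation.Nullary.Negation.Core using (¬_)
open import Relation.Unary using (_≐_; ∁; _∈_; Satisfiable)

-- The integers inside an ordered field.

module IntegerEmbedding (R : CompleteOrderedField) where

  open CompleteOrderedField R
  open Mult semiring using (×-homo-+; ×1-homo-*)
  open RingProperties ring using (-‿involutive; -0#≈0#; -‿distribˡ-*; -‿distribʳ-*; -‿+-comm)
  open SetoidReasoning setoid

  fromℤ-neg : ∀ i → fromℤ (ℤ.- i) ≈ - fromℤ i
  fromℤ-neg (+ zero)  = sym -0#≈0#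
  fromℤ-neg (+ suc n) = refl
  fromℤ-neg -[1+ n ]  = sym (-‿involutive _)

  fromℤ-⊖ : ∀ m n → fromℤ (m ⊖ n) ≈ m · 1# - n · 1#
  fromℤ-⊖ m zero = sym (trans (+-congˡ -0#≈0#) (+-identityʳ _))
  fromℤ-⊖ zero (suc n) = sym (+-identityˡ _)
  fromℤ-⊖ (suc m) (suc n) = begin
    fromℤ (suc m ⊖ suc n)                  ≡⟨ ≡.cong fromℤ (ℤ.[1+m]⊖[1+n]≡m⊖n m n) ⟩
    fromℤ (m ⊖ n)                          ≈⟨ fromℤ-⊖ m n ⟩
    m · 1# - n · 1#                        ≈⟨ +-congʳ (+-identityˡ _) ⟨
    (0# + m · 1#) - n · 1#                 ≈⟨ +-congʳ (+-congʳ (-‿inverseʳ 1#)) ⟨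
    (1# - 1# + m · 1#) - n · 1#            ≈⟨ +-congʳ (+-assoc _ _ _) ⟩
    (1# + (- 1# + m · 1#)) - n · 1#        ≈⟨ +-congʳ (+-congˡ (+-comm _ _)) ⟩
    (1# + (m · 1# - 1#)) - n · 1#          ≈⟨ +-congʳ (+-assoc _ _ _) ⟨
    (1# + m · 1# - 1#) - n · 1#            ≈⟨ +-assoc _ _ _ ⟩
    1# + m · 1# + (- 1# - n · 1#)          ≈⟨ +-congˡ (-‿+-comm _ _) ⟩
    1# + m · 1# - (1# + n · 1#)            ∎

  fromℤ-+ : ∀ i j → fromℤ (i ℤ.+ j) ≈ fromℤ i + fromℤ j
  fromℤ-+ (+ m)    (+ n)    = ×-homo-+ 1# m n
  fromℤ-+ (+ m)    -[1+ n ] = fromℤ-⊖ m (suc n)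
  fromℤ-+ -[1+ m ] (+ n)    = trans (fromℤ-⊖ n (suc m)) (+-comm _ _)
  fromℤ-+ -[1+ m ] -[1+ n ] = begin
    - (suc (suc (m ℕ.+ n)) · 1#)     ≡⟨ ≡.cong (λ k → - (suc k · 1#)) (ℕ.+-suc m n) ⟨
    - ((suc m ℕ.+ suc n) · 1#)       ≈⟨ -‿cong (×-homo-+ 1# (suc m) (suc n)) ⟩
    - (suc m · 1# + suc n · 1#)      ≈⟨ -‿+-comm _ _ ⟨
    - (suc m · 1#) - (suc n · 1#)    ∎

  -- Integer multiplication is defined by sign and magnitude, so images in the field are brought to
  -- the same form before being multiplied.
  signed : Sign → Carrier → Carrier
  signed Sign.+ x = x
  signed Sign.- x = - x

  signed-* : ∀ s t x y → signed (s Sign.* t) (x * y) ≈ signed s x * signed t y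
  signed-* Sign.+ Sign.+ x y = refl
  signed-* Sign.+ Sign.- x y = -‿distribʳ-* x y
  signed-* Sign.- Sign.+ x y = -‿distribˡ-* x y
  signed-* Sign.- Sign.- x y = begin
    x * y          ≈⟨ -‿involutive _ ⟨
    - - (x * y)    ≈⟨ -‿cong (-‿distribʳ-* x y) ⟩
    - (x * - y)    ≈⟨ -‿distribˡ-* x (- y) ⟩
    - x * - y      ∎

  signed-cong : ∀ s {x y} → x ≈ y → signed s x ≈ signed s y
  signed-cong Sign.+ = λ eq → eq
  signed-cong Sign.- = -‿cong

  fromℤ-◃ : ∀ s n → fromℤ (s ◃ n) ≈ signed s (n · 1#)
  fromℤ-◃ Sign.+ zero    = refl
  fromℤ-◃ Sign.- zero    = sym -0#≈0#
  fromℤ-◃ Sign.+ (suc n) = refl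
  fromℤ-◃ Sign.- (suc n) = refl

  fromℤ-signed : ∀ i → fromℤ i ≈ signed (ℤ.sign i) (ℤ.∣ i ∣ · 1#)
  fromℤ-signed (+ n)    = refl
  fromℤ-signed -[1+ n ] = refl

  fromℤ-* : ∀ i j → fromℤ (i ℤ.* j) ≈ fromℤ i * fromℤ j
  fromℤ-* i j = begin
    fromℤ (i ℤ.* j)                                       ≈⟨ fromℤ-◃ (s Sign.* t) (ℤ.∣ i ∣ ℕ.* ℤ.∣ j ∣) ⟩
    signed (s Sign.* t) ((ℤ.∣ i ∣ ℕ.* ℤ.∣ j ∣) · 1#)      ≈⟨ signed-cong (s Sign.* t) (×1-homo-* ℤ.∣ i ∣ ℤ.∣ j ∣) ⟩
    signed (s Sign.* t) (ℤ.∣ i ∣ · 1# * ℤ.∣ j ∣ · 1#)     ≈⟨ signed-* s t _ _ ⟩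
    signed s (ℤ.∣ i ∣ · 1#) * signed t (ℤ.∣ j ∣ · 1#)     ≈⟨ *-cong (fromℤ-signed i) (fromℤ-signed j) ⟨
    fromℤ i * fromℤ j                                     ∎
    where
    s = ℤ.sign i
    t = ℤ.sign j

  private
    morphism : ℤ.+-*-rawRing -Raw-AlmostCommutative⟶ fromCommutativeRing commutativeRing
    morphism = record
      { ⟦_⟧    = fromℤ
      ; +-homo = fromℤ-+
      ; *-homo = fromℤ-*
      ; -‿homo = fromℤ-neg
      ; 0-homo = refl
      ; 1-homo = +-identityʳ 1#
      }

  -- Integer coefficients, unlike coefficients in R itself, have decidable
  -- equality that computes, so that x - x normalises to 0.
  module Solver = RingSolver ℤ.+-*-rawRing (fromCommutativeRing commutativeRing) morphism
    (λ i j → Maybe.map (λ i≡j → reflexive (≡.cong fromℤ i≡j)) (dec⇒maybe (i ℤ.≟ j)))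

module Approximation (lem : ExcludedMiddle 0ℓ) (R : CompleteOrderedField) (e : ℕ) where

  -- Writing the positive dimension as a successor lets `x ^ d` unfold to `x * x ^ e`.
  d : ℕ
  d = suc e

  open CompleteOrderedField R hiding (zero)
  open IntegerEmbedding R
  open DiophantineApproximation R d
  open Exp commutativeSemiring using (^-congˡ; ^-distrib-*)
  open Mult semiring using (×-homo-+; ×-congʳ; ×-assoc-*; ×-comm-*)
  open Max totalOrder using (⊔-idem; ⊔-mono-≤; ⊔-sel)
  open Solver using (solve; _:=_; _:+_; _:*_; _:-_; :-_; con)
  open PartialOrderReasoning (TotalOrder.poset totalOrder)

  -- Arithmetic of ordered fields.

  ≰⇒> : ∀ {x y} → ¬ (x ≤ y) → y < x
  ≰⇒> = ToStrict.≰⇒> _≈_ _≤_ sym ≤-reflexive ≤-total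

  <⇒≱ : ∀ {x y} → x < y → ¬ (y ≤ x)
  <⇒≱ = ToStrict.<⇒≱ _≈_ _≤_ ≤-antisym

  <⇒≤ : ∀ {x y} → x < y → x ≤ y
  <⇒≤ = proj₁

  ≤-<-trans : ∀ {x y z} → x ≤ y → y < z → x < z
  ≤-<-trans = ToStrict.≤-<-trans _≈_ _≤_ ≤-trans ≤-antisym ≤-respˡ-≈

  <-≤-trans : ∀ {x y z} → x < y → y ≤ z → x < z
  <-≤-trans = ToStrict.<-≤-trans _≈_ _≤_ sym ≤-trans ≤-antisym ≤-respʳ-≈

  +-monoʳ-≤ : ∀ z {x y} → x ≤ y → z + x ≤ z + y
  +-monoʳ-≤ z {x} {y} x≤y = begin
    z + x  ≈⟨ +-comm z x ⟩
    x + z  ≤⟨ +-monoˡ-≤ z x≤y ⟩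
    y + z  ≈⟨ +-comm y z ⟩
    z + y  ∎

  +-mono-≤ : ∀ {x y u v} → x ≤ y → u ≤ v → x + u ≤ y + v
  +-mono-≤ {y = y} {u = u} x≤y u≤v = ≤-trans (+-monoˡ-≤ u x≤y) (+-monoʳ-≤ y u≤v)

  -- Rearranging an inequality becomes a ring identity between differences, which the solver
  -- settles.
  ≤-by-difference : ∀ {x y u v} → x ≤ y → y - x ≈ v - u → u ≤ v
  ≤-by-difference {x} {y} {u} {v} x≤y eq = begin
    u              ≈⟨ solve 2 (λ x u → u := x :+ (u :- x)) refl x u ⟩
    x + (u - x)    ≤⟨ +-monoˡ-≤ (u - x) x≤y ⟩
    y + (u - x)    ≈⟨ solve 3 (λ x y u → y :+ (u :- x) := (y :- x) :+ u) refl x y u ⟩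
    (y - x) + u    ≈⟨ +-congʳ eq ⟩
    (v - u) + u    ≈⟨ solve 2 (λ u v → (v :- u) :+ u := v) refl u v ⟩
    v              ∎

  <-by-difference : ∀ {x y u v} → x < y → y - x ≈ v - u → u < v
  <-by-difference {x} {y} {u} {v} x<y eq = ≰⇒> λ v≤u → <⇒≱ x<y
    (≤-by-difference v≤u (begin-equality
      u - v        ≈⟨ solve 2 (λ u v → u :- v := :- (v :- u)) refl u v ⟩
      - (v - u)    ≈⟨ -‿cong eq ⟨
      - (y - x)    ≈⟨ solve 2 (λ x y → :- (y :- x) := x :- y) refl x y ⟩
      x - y        ∎))

  0<1 : 0# < 1#
  0<1 = 0≤1 , 0≉1

  *-pos : ∀ {x y} → 0# < x → 0# < y → 0# < x * y
  *-pos {x} {y} (0≤x , 0≉x) (0≤y , 0≉y) = *-nonNeg 0≤x 0≤y , λ 0≈xy → 0≉y (begin-equality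
    0#                ≈⟨ zeroʳ x⁻¹ ⟨
    x⁻¹ * 0#          ≈⟨ *-congˡ 0≈xy ⟩
    x⁻¹ * (x * y)     ≈⟨ solve 3 (λ x y z → z :* (x :* y) := (x :* z) :* y) refl x y x⁻¹ ⟩
    x * x⁻¹ * y       ≈⟨ *-congʳ x*x⁻¹≈1 ⟩
    1# * y            ≈⟨ *-identityˡ y ⟩
    y                 ∎)
    where
    x⁻¹ = proj₁ (inverse x λ x≈0 → 0≉x (sym x≈0))
    x*x⁻¹≈1 = proj₂ (inverse x λ x≈0 → 0≉x (sym x≈0))

  0≤y-x : ∀ {x y} → x ≤ y → 0# ≤ y - x
  0≤y-x {x} {y} x≤y = ≤-by-difference x≤y
    (solve 2 (λ x y → y :- x := (y :- x) :- con (+ 0)) refl x y)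

  *-monoˡ-≤ : ∀ {z} → 0# ≤ z → ∀ {x y} → x ≤ y → z * x ≤ z * y
  *-monoˡ-≤ {z} 0≤z {x} {y} x≤y = ≤-by-difference (*-nonNeg 0≤z (0≤y-x x≤y))
    (solve 3 (λ x y z → z :* (y :- x) :- con (+ 0) := z :* y :- z :* x) refl x y z)

  *-mono-≤ : ∀ {x y u v} → 0# ≤ u → x ≤ y → u ≤ v → 0# ≤ y → x * u ≤ y * v
  *-mono-≤ {x} {y} {u} {v} 0≤u x≤y u≤v 0≤y = begin
    x * u  ≈⟨ *-comm x u ⟩
    u * x  ≤⟨ *-monoˡ-≤ 0≤u x≤y ⟩
    u * y  ≈⟨ *-comm u y ⟩
    y * u  ≤⟨ *-monoˡ-≤ 0≤y u≤v ⟩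
    y * v  ∎

  positiveInverse : ∀ {x} → 0# < x → ∃ λ y → 0# < y × x * y ≈ 1#
  positiveInverse {x} 0<x@(0≤x , 0≉x) with y , xy≈1 ← inverse x (λ x≈0 → 0≉x (sym x≈0)) =
    y , ≰⇒> (λ y≤0 → <⇒≱ 0<1 (begin
      1#        ≈⟨ xy≈1 ⟨
      x * y     ≤⟨ *-monoˡ-≤ 0≤x y≤0 ⟩
      x * 0#    ≈⟨ zeroʳ x ⟩
      0#        ∎)) , xy≈1

  ·-monoʳ-≤ : ∀ n {x y} → x ≤ y → n · x ≤ n · y
  ·-monoʳ-≤ zero    x≤y = ≤-refl
  ·-monoʳ-≤ (suc n) x≤y = +-mono-≤ x≤y (·-monoʳ-≤ n x≤y)

  ·-zeroʳ : ∀ n → n · 0# ≈ 0#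
  ·-zeroʳ zero    = refl
  ·-zeroʳ (suc n) = trans (+-identityˡ _) (·-zeroʳ n)

  x≤[1+n]·x : ∀ n {x} → 0# ≤ x → x ≤ suc n · x
  x≤[1+n]·x n {x} 0≤x = begin
    x            ≈⟨ +-identityʳ x ⟨
    x + 0#       ≤⟨ +-monoʳ-≤ x (·-nonNeg n 0≤x) ⟩
    x + n · x    ∎

  [1+n]·-pos : ∀ n {x} → 0# < x → 0# < suc n · x
  [1+n]·-pos n 0<x = <-≤-trans 0<x (x≤[1+n]·x n (<⇒≤ 0<x))

  ^-mono-≤ : ∀ n {x y} → 0# ≤ x → x ≤ y → x ^ n ≤ y ^ n
  ^-mono-≤ zero    0≤x x≤y = ≤-refl
  ^-mono-≤ (suc n) 0≤x x≤y =
    *-mono-≤ (^-nonNeg n 0≤x) x≤y (^-mono-≤ n 0≤x x≤y) (≤-trans 0≤x x≤y)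

  ^-pos : ∀ n {x} → 0# < x → 0# < x ^ n
  ^-pos zero    0<x = 0<1
  ^-pos (suc n) 0<x = *-pos 0<x (^-pos n 0<x)

  x^[1+n]≤x : ∀ n {x} → 0# ≤ x → x ≤ 1# → x ^ suc n ≤ x
  x^[1+n]≤x n {x} 0≤x x≤1 = begin
    x * x ^ n    ≤⟨ *-monoˡ-≤ 0≤x (^≤1 n) ⟩
    x * 1#       ≈⟨ *-identityʳ x ⟩
    x            ∎
    where
    ^≤1 : ∀ n → x ^ n ≤ 1#
    ^≤1 zero    = ≤-refl
    ^≤1 (suc n) = begin
      x * x ^ n    ≤⟨ *-mono-≤ (^-nonNeg n 0≤x) x≤1 (^≤1 n) 0≤1 ⟩
      1# * 1#      ≈⟨ *-identityˡ 1# ⟩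
      1#           ∎

  divide : ∀ n {x} → 0# < x → ∃ λ y → 0# < y × suc n · y ≈ x
  divide n {x} 0<x = divideBy (positiveInverse ([1+n]·-pos n 0<1))
    where
    divideBy : (∃ λ w → 0# < w × suc n · 1# * w ≈ 1#) → ∃ λ y → 0# < y × suc n · y ≈ x
    divideBy (w , 0<w , Nw≈1) = w * x , *-pos 0<w 0<x , (begin-equality
      suc n · (w * x)            ≈⟨ ×-congʳ (suc n) (*-identityˡ (w * x)) ⟨
      suc n · (1# * (w * x))     ≈⟨ ×-assoc-* (suc n) 1# (w * x) ⟨
      (suc n · 1#) * (w * x)     ≈⟨ *-assoc (suc n · 1#) w x ⟨
      (suc n · 1#) * w * x       ≈⟨ *-congʳ Nw≈1 ⟩
      1# * x                     ≈⟨ *-identityˡ x ⟩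
      x                          ∎)

  -- Here `κ` is 1/n. The case n = 2 serves badly approximable vectors, n = 4 well approximable
  -- ones.
  ^-unscale : ∀ n {κ} → n · κ ≈ 1# → ∀ d x → κ ^ d * (n · x) ^ d ≈ x ^ d
  ^-unscale n {κ} nκ≈1 d x = begin-equality
    κ ^ d * (n · x) ^ d    ≈⟨ ^-distrib-* κ (n · x) d ⟨
    (κ * n · x) ^ d        ≈⟨ ^-congˡ d (begin-equality
      κ * n · x              ≈⟨ ×-comm-* n κ x ⟩
      n · (κ * x)            ≈⟨ ×-assoc-* n κ x ⟨
      n · κ * x              ≈⟨ *-congʳ nκ≈1 ⟩
      1# * x                 ≈⟨ *-identityˡ x ⟩
      x                      ∎) ⟩
    x ^ d                  ∎

  half : ∀ {x} → 0# < x → ∃ λ y → 0# < y × y + y ≈ x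
  half 0<x = let y , 0<y , eq = divide 1 0<x in y , 0<y , trans (+-congˡ (sym (+-identityʳ y))) eq

  ⊔-lub : ∀ {x y z} → x ≤ z → y ≤ z → x ⊔ y ≤ z
  ⊔-lub {x} {y} {z} x≤z y≤z = ≤-respʳ-≈ (⊔-idem z) (⊔-mono-≤ x≤z y≤z)

  ⊔-lub-< : ∀ {x y z} → x < z → y < z → x ⊔ y < z
  ⊔-lub-< {x} {y} {z} x<z y<z = [ below x<z , below y<z ]′ (⊔-sel x y)
    where
    below : ∀ {u} → u < z → x ⊔ y ≈ u → x ⊔ y < z
    below u<z eq = ≤-<-trans (≤-reflexive eq) u<z

  x≤∣x∣ : ∀ x → x ≤ ∣ x ∣
  x≤∣x∣ x = x≤x⊔y x (- x)

  -x≤∣x∣ : ∀ x → - x ≤ ∣ x ∣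
  -x≤∣x∣ x = x≤y⊔x x (- x)

  -- Monotone sequences, infima and series.

  Nondecreasing : (ℕ → Carrier) → Set
  Nondecreasing s = ∀ n → s n ≤ s (suc n)

  nondecreasing-+ : ∀ {s} → Nondecreasing s → ∀ m n → s n ≤ s (m ℕ.+ n)
  nondecreasing-+ s↑ zero    n = ≤-refl
  nondecreasing-+ s↑ (suc m) n = ≤-trans (nondecreasing-+ s↑ m n) (s↑ (m ℕ.+ n))

  nondecreasing-≤ : ∀ {s} → Nondecreasing s → ∀ {m n} → m ℕ.≤ n → s m ≤ s n
  nondecreasing-≤ {s} s↑ {m} {n} m≤n =
    ≡.subst (λ k → s m ≤ s k) (ℕ.m∸n+n≡m m≤n) (nondecreasing-+ s↑ (n ℕ.∸ m) m)

  -- Every right endpoint bounds all left endpoints, so the supremum of the left endpoints lies in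
  -- each interval.
  nestedIntervals : (a b : ℕ → Carrier) → Nondecreasing a → (∀ n → b (suc n) ≤ b n) →
    (∀ n → a n ≤ b n) → ∃ λ x → ∀ n → a n ≤ x × x ≤ b n
  nestedIntervals a b a↑ b↓ a≤b =
    proj₁ sup , λ n →
      proj₁ (proj₂ sup) (a n) (n , refl) ,
      proj₂ (proj₂ sup) (b n) (λ x x∈a → ≤-respˡ-≈ (proj₂ x∈a) (crossing (proj₁ x∈a) n))
    where
    -b↑ : Nondecreasing (λ n → - b n)
    -b↑ n = ≤-by-difference (b↓ n) (solve 2 (λ x y → x :- y := :- y :- :- x) refl (b n) (b (suc n)))

    b↓-≤ : ∀ {m n} → m ℕ.≤ n → b n ≤ b m
    b↓-≤ {m} {n} m≤n = ≤-by-difference (nondecreasing-≤ -b↑ m≤n)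
      (solve 2 (λ x y → :- y :- :- x := x :- y) refl (b m) (b n))

    crossing : ∀ m n → a m ≤ b n
    crossing m n = begin
      a m              ≤⟨ nondecreasing-≤ a↑ (ℕ.m≤m⊔n m n) ⟩
      a (m ℕ.⊔ n)      ≤⟨ a≤b (m ℕ.⊔ n) ⟩
      b (m ℕ.⊔ n)      ≤⟨ b↓-≤ (ℕ.m≤n⊔m m n) ⟩
      b n              ∎

    sup = supremum (λ x → ∃ λ n → a n ≈ x) (a 0 , 0 , refl)
            (b 0 , λ x x∈a → ≤-respˡ-≈ (proj₂ x∈a) (crossing (proj₁ x∈a) 0))

  -- Otherwise `x` would be a lower bound exceeding the greatest one.
  inf-approx : {I : Set} (f : I → ℝ) (i₀ : I) (bounded : Satisfiable (IsLowerBoundOf f)) →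
    ∀ {x} → inf f i₀ bounded < x → ∃ λ i → f i < x
  inf-approx f i₀ bounded {x} inf<x = em⇒dne lem λ none →
    <⇒≱ inf<x (inf-greatest f i₀ bounded x λ i →
      em⇒dne lem λ x≰fi → none (i , ≰⇒> x≰fi))

  boundedMonotone⇒converges : (s : ℕ → ℝ) → Nondecreasing s →
    (b : ℝ) → (∀ n → s n ≤ b) → ∃ (ConvergesTo s)
  boundedMonotone⇒converges s s↑ b s≤b = l , converges
    where
    sup = supremum (λ x → ∃ λ n → s n ≈ x) (s 0 , 0 , refl)
            (b , λ x x∈s → ≤-respˡ-≈ (proj₂ x∈s) (s≤b (proj₁ x∈s)))
    l = proj₁ sup

    s≤l : ∀ n → s n ≤ l
    s≤l n = proj₁ (proj₂ sup) (s n) (n , refl)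

    converges : ConvergesTo s l
    converges ε 0<ε = let N , l-ε<sN = approx in N , λ n N≤n →
      ⊔-lub-<
        (begin-strict
          s n - l    ≤⟨ +-monoˡ-≤ (- l) (s≤l n) ⟩
          l - l      ≈⟨ -‿inverseʳ l ⟩
          0#         <⟨ 0<ε ⟩
          ε          ∎)
        (<-by-difference (<-≤-trans l-ε<sN (nondecreasing-≤ s↑ N≤n))
          (solve 3 (λ l ε s → s :- (l :- ε) := ε :- :- (s :- l)) refl l ε (s n)))
      where
      approx : ∃ λ N → l - ε < s N
      approx = em⇒dne lem λ none → <⇒≱ 0<ε
        (≤-by-difference
          (proj₂ (proj₂ sup) (l - ε) λ x x∈s → ≤-respˡ-≈ (proj₂ x∈s)
            (em⇒dne lem λ s≰ → none (proj₁ x∈s , ≰⇒> s≰)))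
          (solve 2 (λ l ε → (l :- ε) :- l := con (+ 0) :- ε) refl l ε))

  -- This one-sided Cauchy bound suffices to refute convergence of a series that has, arbitrarily
  -- far out, blocks of sum at least ε.
  converges⇒cauchy : ∀ {s l} → ConvergesTo s l → ∀ ε → 0# < ε →
    ∃ λ N → ∀ m n → N ℕ.≤ m → N ℕ.≤ n → s n < s m + ε
  converges⇒cauchy {s} {l} s→l ε 0<ε =
    let δ , 0<δ , δ+δ≈ε = half 0<ε
        N , close = s→l δ 0<δ
    in N , λ m n N≤m N≤n → begin-strict
      s n              <⟨ <-by-difference (≤-<-trans (x≤∣x∣ (s n - l)) (close n N≤n))
                            (solve 3 (λ s l δ → δ :- (s :- l) := (l :+ δ) :- s) refl (s n) l δ) ⟩
      l + δ            ≤⟨ +-monoˡ-≤ δ (≤-by-difference (≤-trans (-x≤∣x∣ (s m - l)) (<⇒≤ (close m N≤m)))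
                            (solve 3 (λ s l δ → δ :- :- (s :- l) := (s :+ δ) :- l) refl (s m) l δ)) ⟩
      s m + δ + δ      ≈⟨ +-assoc (s m) δ δ ⟩
      s m + (δ + δ)    ≈⟨ +-congˡ δ+δ≈ε ⟩
      s m + ε          ∎

  partialSum-upper : ∀ a {k c} → (∀ j → k ℕ.≤ j → a (suc j , _) ≤ c) →
    ∀ m → partialSum a (m ℕ.+ k) ≤ partialSum a k + m · c
  partialSum-upper a {k} {c} a≤c zero    = ≤-reflexive (sym (+-identityʳ _))
  partialSum-upper a {k} {c} a≤c (suc m) = begin
    partialSum a (m ℕ.+ k) + a _       ≤⟨ +-mono-≤ (partialSum-upper a a≤c m) (a≤c _ (ℕ.m≤n+m k m)) ⟩
    partialSum a k + m · c + c         ≈⟨ +-assoc _ _ _ ⟩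
    partialSum a k + (m · c + c)       ≈⟨ +-congˡ (+-comm _ _) ⟩
    partialSum a k + (c + m · c)       ∎

  partialSum-lower : ∀ a {k c} m → (∀ j → j ℕ.< m ℕ.+ k → c ≤ a (suc j , _)) →
    partialSum a k + m · c ≤ partialSum a (m ℕ.+ k)
  partialSum-lower a {k} {c} zero    c≤a = ≤-reflexive (+-identityʳ _)
  partialSum-lower a {k} {c} (suc m) c≤a = begin
    partialSum a k + (c + m · c)       ≈⟨ +-congˡ (+-comm _ _) ⟩
    partialSum a k + (m · c + c)       ≈⟨ +-assoc _ _ _ ⟨
    partialSum a k + m · c + c         ≤⟨ +-mono-≤ (partialSum-lower a m λ j j< → c≤a j (ℕ.m<n⇒m<1+n j<)) (c≤a _ ℕ.≤-refl) ⟩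
    partialSum a (m ℕ.+ k) + a _       ∎

  -- The sup norm and the distance to the integer lattice.

  ∣∣≤supNorm : ∀ {k} (z : Vector ℝ k) i → ∣ z i ∣ ≤ supNorm z
  ∣∣≤supNorm z zero    = x≤x⊔y _ _
  ∣∣≤supNorm z (suc i) = ≤-trans (∣∣≤supNorm (λ j → z (suc j)) i) (x≤y⊔x _ _)

  supNorm-lub : ∀ {k} (z : Vector ℝ k) {r} → 0# ≤ r → (∀ i → ∣ z i ∣ ≤ r) → supNorm z ≤ r
  supNorm-lub {zero}  z 0≤r z≤r = 0≤r
  supNorm-lub {suc k} z 0≤r z≤r = ⊔-lub (z≤r zero) (supNorm-lub (λ j → z (suc j)) 0≤r (λ j → z≤r (suc j)))

  ∣-∣-triangle : ∀ {x y z} → x ≈ y - z → ∣ x ∣ ≤ ∣ y ∣ + ∣ z ∣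
  ∣-∣-triangle {x} {y} {z} eq = ⊔-lub
    (begin
      x                ≈⟨ eq ⟩
      y - z            ≤⟨ +-mono-≤ (x≤∣x∣ y) (-x≤∣x∣ z) ⟩
      ∣ y ∣ + ∣ z ∣    ∎)
    (begin
      - x              ≈⟨ -‿cong eq ⟩
      - (y - z)        ≈⟨ solve 2 (λ y z → :- (y :- z) := :- y :+ z) refl y z ⟩
      - y + z          ≤⟨ +-mono-≤ (-x≤∣x∣ y) (x≤∣x∣ z) ⟩
      ∣ y ∣ + ∣ z ∣    ∎)

  ‖‖≤distance : ∀ z m → ‖ z ‖ ≤ distance z m
  ‖‖≤distance z = inf-lower (distance z) (λ _ → + 0) (0# , 0≤distance z)

  distance-triangle : ∀ {u z w} → u ≋ z -ᵛ w →
    ∀ m l → distance u (zipWith ℤ._-_ m l) ≤ distance z m + distance w l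
  distance-triangle {u} {z} {w} u≋z-w m l =
    supNorm-lub (u -ᵛ (λ i → fromℤ (m i ℤ.- l i))) (+-nonNeg (0≤distance z m) (0≤distance w l)) λ i → ≤-trans
      (∣-∣-triangle (begin-equality
        u i - fromℤ (m i ℤ.- l i)
          ≈⟨ +-cong (u≋z-w i) (-‿cong (trans (fromℤ-+ (m i) (ℤ.- l i)) (+-congˡ (fromℤ-neg (l i))))) ⟩
        (z i - w i) - (fromℤ (m i) - fromℤ (l i))
          ≈⟨ solve 4 (λ z w m l → (z :- w) :- (m :- l) := (z :- m) :- (w :- l)) refl
               (z i) (w i) (fromℤ (m i)) (fromℤ (l i)) ⟩
        (z i - fromℤ (m i)) - (w i - fromℤ (l i))
          ∎))
      (+-mono-≤ (∣∣≤supNorm (z -ᵛ (λ j → fromℤ (m j))) i) (∣∣≤supNorm (w -ᵛ (λ j → fromℤ (l j))) i))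

  -- The two infima are taken one after the other: for fixed `m`, `‖ u ‖ - distance z m` is a lower
  -- bound of the distances of `w`; hence `‖ u ‖ - ‖ w ‖` is one of the distances of `z`.
  ‖‖-triangle : ∀ {u z w} → u ≋ z -ᵛ w → ‖ u ‖ ≤ ‖ z ‖ + ‖ w ‖
  ‖‖-triangle {u} {z} {w} u≋z-w =
    ≤-by-difference
      (inf-greatest (distance z) (λ _ → + 0) (0# , 0≤distance z) (‖ u ‖ - ‖ w ‖) λ m →
        ≤-by-difference
          (inf-greatest (distance w) (λ _ → + 0) (0# , 0≤distance w) (‖ u ‖ - distance z m) λ l →
            ≤-by-difference (≤-trans (‖‖≤distance u (zipWith ℤ._-_ m l)) (distance-triangle {u} {z} {w} u≋z-w m l))
              (solve 3 (λ u z w → (z :+ w) :- u := w :- (u :- z)) refl (‖ u ‖) (distance z m) (distance w l)))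
          (solve 3 (λ u z w → w :- (u :- z) := z :- (u :- w)) refl (‖ u ‖) (distance z m) (‖ w ‖)))
      (solve 3 (λ u z w → z :- (u :- w) := (z :+ w) :- u) refl (‖ u ‖) (‖ z ‖) (‖ w ‖))

  -- Record minima of a sequence whose small values are far apart.

  module RecordMinima (f : ℕ → ℝ) (c : ℝ) (0<c : 0# < c)
    (gap : ∀ (q k : ℕ) {t : ℝ} → f k ≤ t → f (suc q ℕ.+ k) ≤ t → c ≤ suc q · (t ^ d)) where

    -- A zero of f is not a record, so that g stays positive.
    Record : ℝ → ℕ → Set
    Record t n = 0# < f n × f n ≤ t

    -- The decision is an argument so that proofs about `g` can split on it in place of `lem`.
    next : (t : ℝ) (n : ℕ) → Dec (Record t n) → ℝ
    next t n (yes _) = f n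
    next t n (no _)  = t

    -- `g n` is the minimum of 1 and the positive values among `f 0`, ..., `f (n - 1)`; thus
    -- `g (suc n)` already takes `f n` into account.
    g : ℕ → ℝ
    g zero    = 1#
    g (suc n) = next (g n) n lem

    g-step : ∀ n → (f n ≤ g n × g (suc n) ≡ f n) ⊎ (g (suc n) ≡ g n)
    g-step n = split lem
      where
      split : (r : Dec (Record (g n) n)) →
        (f n ≤ g n × next (g n) n r ≡ f n) ⊎ (next (g n) n r ≡ g n)
      split (yes (_ , f≤g)) = inj₁ (f≤g , ≡.refl)
      split (no _)          = inj₂ ≡.refl

    0<g : ∀ n → 0# < g n
    0<g zero    = 0<1
    0<g (suc n) = split lem
      where
      split : (r : Dec (Record (g n) n)) → 0# < next (g n) n r
      split (yes (0<f , _)) = 0<f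
      split (no _)          = 0<g n

    -- At a record `g (suc n)` equals `f n`. Otherwise `f n` lies below `g n`, and only failing to
    -- be positive keeps it from being a record.
    f<g⇒f≤0 : ∀ n → f n < g (suc n) → f n ≤ 0#
    f<g⇒f≤0 n = split lem
      where
      split : (r : Dec (Record (g n) n)) → f n < next (g n) n r → f n ≤ 0#
      split (yes _)  f<f = ⊥-elim (<⇒≱ f<f ≤-refl)
      split (no ¬r) f<g = em⇒dne lem λ f≰0 → ¬r (≰⇒> f≰0 , <⇒≤ f<g)

    g-step-≤ : ∀ n → g (suc n) ≤ g n
    g-step-≤ n =
      [ (λ (f≤g , g≡f) → ≤-respˡ-≈ (reflexive (≡.sym g≡f)) f≤g)
      , (λ g≡g → ≤-reflexive (reflexive g≡g))
      ]′ (g-step n)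

    g-nonincreasing : ∀ {m n} → m ℕ.≤ n → g n ≤ g m
    g-nonincreasing m≤n = descend (ℕ.≤⇒≤′ m≤n)
      where
      descend : ∀ {m n} → m ℕ.≤′ n → g n ≤ g m
      descend (ℕ.≤′-reflexive ≡.refl) = ≤-refl
      descend (ℕ.≤′-step {n} m≤n)       = ≤-trans (g-step-≤ n) (descend m≤n)

    ψ : ℕ⁺ → ℝ
    ψ n = g (toℕ n)

    ψ^d : ℕ⁺ → ℝ
    ψ^d n = ψ n ^ d

    -- The search goes back from `m` to the step at which `g` first falls below `g N`. Since `g`
    -- changes there, that step is a record.
    firstDrop : ∀ N m → g (m ℕ.+ N) < g N →
      ∃ λ j → g N ≤ g (j ℕ.+ N) × f (j ℕ.+ N) ≤ g N × g (suc (j ℕ.+ N)) ≡ f (j ℕ.+ N)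
    firstDrop N zero    g<g = ⊥-elim (<⇒≱ g<g ≤-refl)
    firstDrop N (suc m) drop = decide lem
      where
      decide : Dec (g (m ℕ.+ N) < g N) → _
      decide (yes earlier) = firstDrop N m earlier
      decide (no ¬earlier) =
        [ (λ (f≤g , g≡f) → m , gN≤ , ≤-trans f≤g (g-nonincreasing (ℕ.m≤n+m N m)) , g≡f)
        , (λ g≡g → ⊥-elim (<⇒≱ drop (≤-respʳ-≈ (reflexive (≡.sym g≡g)) gN≤)))
        ]′ (g-step (m ℕ.+ N))
        where
        gN≤ : g N ≤ g (m ℕ.+ N)
        gN≤ = em⇒dne lem λ ≰ → ¬earlier (≰⇒> ≰)

    ψ-divergent : SeriesDiverges ψ^d
    ψ-divergent (l , s→l) =
      let M , cauchy       = converges⇒cauchy s→l c 0<c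
          i , _ , _ , g≡f  = nextDrop M
          k                = i ℕ.+ M
          -- Restarting just after `k` gives a second, later record, with `t` equal to `f k`.
          j , t≤g , f≤t , _ = nextDrop (suc k)
          t                = g (suc k)
          l≡               = ℕ.+-suc j k
          M≤k              = ℕ.m≤n+m M i
      in <⇒≱ (cauchy k (suc j ℕ.+ k) M≤k (ℕ.≤-trans M≤k (ℕ.m≤n+m k (suc j)))) (begin
        s k + c                   ≤⟨ +-monoʳ-≤ (s k) (gap j k
                                       -- `gap` applies because `f` is at most `t` at both records.
                                       -- In the next step `g` is still at least `t` at the end of
                                       -- the block, hence throughout it.
                                       (≤-reflexive (reflexive (≡.sym g≡f)))
                                       (≡.subst (λ l → f l ≤ t) l≡ f≤t)) ⟩
        s k + suc j · (t ^ d)     ≤⟨ partialSum-lower ψ^d (suc j) (λ n n<l → ^-mono-≤ d (<⇒≤ (0<g (suc k)))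
                                       (≤-trans (≡.subst (λ l → t ≤ g l) l≡ t≤g) (g-nonincreasing n<l))) ⟩
        s (suc j ℕ.+ k)           ∎)
      where
      s = partialSum ψ^d

      -- If `g` never fell below the positive value `g N`, the terms of the series would not tend to
      -- zero.
      drops : ∀ N → ∃ λ m → g (m ℕ.+ N) < g N
      drops N = em⇒dne lem λ constant →
        let M , cauchy = converges⇒cauchy s→l (g N ^ d) (^-pos d (0<g N))
            k = M ℕ.+ N
        in <⇒≱ (cauchy k (suc k) (ℕ.m≤m+n M N) (ℕ.m≤n⇒m≤1+n (ℕ.m≤m+n M N)))
             (+-monoʳ-≤ (s k) (^-mono-≤ d (<⇒≤ (0<g N))
               (em⇒dne lem λ ≰ → constant (suc M , ≰⇒> ≰))))

      nextDrop : ∀ N → ∃ λ j → g N ≤ g (j ℕ.+ N) × f (j ℕ.+ N) ≤ g N × g (suc (j ℕ.+ N)) ≡ f (j ℕ.+ N)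
      nextDrop N = firstDrop N (proj₁ (drops N)) (proj₂ (drops N))

    ψ∈𝒟 : 𝒟 ψ
    ψ∈𝒟 = record
      { nonNegative   = λ n → <⇒≤ (0<g (toℕ n))
      ; nonIncreasing = λ m n → g-nonincreasing
      ; divergent     = ψ-divergent
      }

    -- With t = 0 the inequality `gap` would read c ≤ 0, as the exponent `d` is positive.
    notInfinitelyOftenZero : ∀ {k l} → f k ≤ 0# → suc k ℕ.≤ l → ¬ (f l ≤ 0#)
    notInfinitelyOftenZero {k} {l} fk≤0 k<l fl≤0 = <⇒≱ 0<c (begin
      c                        ≤⟨ gap q k fk≤0 (≡.subst (λ l → f l ≤ 0#) (≡.sym l≡) fl≤0) ⟩
      suc q · (0# * 0# ^ e)    ≈⟨ ×-congʳ (suc q) (zeroˡ _) ⟩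
      suc q · 0#               ≈⟨ ·-zeroʳ (suc q) ⟩
      0#                       ∎)
      where
      q = l ℕ.∸ suc k
      l≡ : suc q ℕ.+ k ≡ l
      l≡ = ≡.trans (≡.sym (ℕ.+-suc q k)) (ℕ.m∸n+n≡m k<l)

  -- Badly approximable vectors.

  module _ {x : ℝᵈ} (x∈Bad : x ∈ Bad) {x₀ : ℝᵈ} (x₀≋x : x₀ ≋ x) (y : ℝᵈ) where

    private
      i = inf (quality x) 1⁺ (0# , 0≤quality x)
      -- This is 1/2; its power undoes the factor 2 from the triangle inequality.
      κ = proj₁ (divide 1 0<1)
      0<κ = proj₁ (proj₂ (divide 1 0<1))
      2κ≈1 = proj₂ (proj₂ (divide 1 0<1))
      0≤κ^d = ^-nonNeg d (<⇒≤ 0<κ)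

    -- Shifted index: orbit n is the distance at time n + 1.
    orbit : ℕ → ℝ
    orbit n = ‖ (suc n , _) ·ᵛ x₀ +ᵛ y ‖

    -- Subtracting two orbit points cancels `y`. The passage from `x₀`, the representative supplied
    -- by `π[ Π ]`, to `x` happens here.
    ‖difference‖ : ∀ q k {t} → orbit k ≤ t → orbit (suc q ℕ.+ k) ≤ t → ‖ (suc q , _) ·ᵛ x ‖ ≤ 2 · t
    ‖difference‖ q k {t} fk≤t fl≤t = begin
      ‖ (suc q , _) ·ᵛ x ‖             ≤⟨ ‖‖-triangle {(suc q , _) ·ᵛ x}
                                           {(suc (suc q ℕ.+ k) , _) ·ᵛ x₀ +ᵛ y} {(suc k , _) ·ᵛ x₀ +ᵛ y}
                                           (λ j → difference (x₀≋x j)) ⟩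
      orbit (suc q ℕ.+ k) + orbit k    ≤⟨ +-mono-≤ fl≤t fk≤t ⟩
      t + t                            ≈⟨ +-congˡ (+-identityʳ t) ⟨
      2 · t                            ∎
      where
      difference : ∀ {a b v} → b ≈ a → suc q · a ≈ (suc (suc q ℕ.+ k) · b + v) - (suc k · b + v)
      difference {a} {b} {v} b≈a = begin-equality
        suc q · a                                        ≈⟨ ×-congʳ (suc q) b≈a ⟨
        suc q · b                                        ≈⟨ solve 3 (λ m n v → m := ((m :+ n) :+ v) :- (n :+ v)) refl
                                                              (suc q · b) (suc k · b) v ⟩
        (suc q · b + suc k · b + v) - (suc k · b + v)    ≈⟨ +-congʳ (+-congʳ (×-homo-+ b (suc q) (suc k))) ⟨
        ((suc q ℕ.+ suc k) · b + v) - (suc k · b + v)    ≡⟨ ≡.cong (λ n → (n · b + v) - (suc k · b + v)) (ℕ.+-suc (suc q) k) ⟩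
        (suc (suc q ℕ.+ k) · b + v) - (suc k · b + v)    ∎

    orbit-gap : ∀ q k {t} → orbit k ≤ t → orbit (suc q ℕ.+ k) ≤ t → κ ^ d * i ≤ suc q · (t ^ d)
    orbit-gap q k {t} fk≤t fl≤t = begin
      κ ^ d * i                              ≤⟨ *-monoˡ-≤ 0≤κ^d (inf-lower (quality x) 1⁺ (0# , 0≤quality x) (suc q , _)) ⟩
      κ ^ d * quality x (suc q , _)          ≤⟨ *-monoˡ-≤ 0≤κ^d (·-monoʳ-≤ (suc q) (^-mono-≤ d (0≤‖z‖ ((suc q , _) ·ᵛ x))
                                                  (‖difference‖ q k fk≤t fl≤t))) ⟩
      κ ^ d * suc q · ((2 · t) ^ d)          ≈⟨ ×-comm-* (suc q) (κ ^ d) ((2 · t) ^ d) ⟩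
      suc q · (κ ^ d * (2 · t) ^ d)          ≈⟨ ×-congʳ (suc q) (^-unscale 2 2κ≈1 d t) ⟩
      suc q · (t ^ d)                        ∎

    open RecordMinima orbit (κ ^ d * i) (*-pos (^-pos d 0<κ) x∈Bad) orbit-gap

    -- A hit at time k + 1 forces `orbit k` to vanish, and there are no two zeros; so it is enough
    -- to ask `often` for one hit and then for a strictly later one.
    missed : ¬ ((x₀ , y) ∈ W ψ)
    missed often = atFirst (often 1)
      where
      Hit : ℕ → ℕ⁺ → Set
      Hit N n = N ℕ.≤ toℕ n × ‖ n ·ᵛ x₀ +ᵛ y ‖ < ψ n

      atSecond : ∀ k → orbit k ≤ 0# → ∃ (Hit (suc (suc k))) → ⊥
      atSecond k fk≤0 ((suc l , _) , s≤s k<l , hit) =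
        notInfinitelyOftenZero fk≤0 k<l (f<g⇒f≤0 l hit)

      atFirst : ∃ (Hit 1) → ⊥
      atFirst ((suc k , _) , s≤s _ , hit) =
        atSecond k (f<g⇒f≤0 k hit) (often (suc (suc k)))

    notInΠ : ¬ ((x₀ , y) ∈ Π)
    notInΠ x₀y∈Π = missed (x₀y∈Π (ψ , ψ∈𝒟))

  -- Choosing denominators for a well approximable vector.

  -- Here a stands for ‖ n x ‖, which may vanish: hence the detour through some t > 0.
  enclosingRadius : ∀ q {a ε} → 0# ≤ a → a ≤ ε → suc q · (a ^ d) ≤ ε → 0# < ε → ε ≤ 1# →
    ∃ λ r → 0# < r × a ≤ r × r ≤ ε × suc q · (r ^ d) ≤ ε
  enclosingRadius q {a} {ε} 0≤a a≤ε qa^d≤ε 0<ε ε≤1 = pick (divide q 0<ε)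
    where
    pick : (∃ λ t → 0# < t × suc q · t ≈ ε) → ∃ λ r → 0# < r × a ≤ r × r ≤ ε × suc q · (r ^ d) ≤ ε
    pick (t , 0<t , qt≈ε) =
      -- The radius is the larger of `a` and t = ε / (q + 1); as t ≤ 1, its d-th power is at most t.
      [ (λ a≤t → t , 0<t , a≤t , t≤ε , (begin
          suc q · (t ^ d)    ≤⟨ ·-monoʳ-≤ (suc q) (x^[1+n]≤x e (<⇒≤ 0<t) (≤-trans t≤ε ε≤1)) ⟩
          suc q · t          ≈⟨ qt≈ε ⟩
          ε                  ∎))
      , (λ t≤a → a , <-≤-trans 0<t t≤a , ≤-refl , a≤ε , qa^d≤ε)
      ]′ (≤-total a t)
      where
      t≤ε : t ≤ ε
      t≤ε = ≤-respʳ-≈ qt≈ε (x≤[1+n]·x q (<⇒≤ 0<t))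

  [1+n]·^-cancel-< : ∀ q {a ε} → 0# ≤ a → 0# ≤ ε → suc q · (a ^ d) < ε ^ d → a ≤ ε
  [1+n]·^-cancel-< q {a} {ε} 0≤a 0≤ε qa^d<ε^d = em⇒dne lem λ a≰ε → <⇒≱ qa^d<ε^d (begin
    ε ^ d              ≤⟨ ^-mono-≤ d 0≤ε (<⇒≤ (≰⇒> a≰ε)) ⟩
    a ^ d              ≤⟨ x≤[1+n]·x q (^-nonNeg d 0≤a) ⟩
    suc q · (a ^ d)    ∎)

  -- The factor 4 instead of 2 leaves room for strictness, which `‖‖-approx` needs to find a lattice
  -- point within δ.
  4a≤2δ⇒a<δ : ∀ {a δ} → 0# < δ → 4 · a ≤ δ + δ → a < δ
  4a≤2δ⇒a<δ {a} {δ} 0<δ 4a≤2δ = ≰⇒> λ δ≤a → <⇒≱ 0<δ (≤-trans (x≤[1+n]·x 1 (<⇒≤ 0<δ))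
    (≤-by-difference (≤-trans (·-monoʳ-≤ 4 δ≤a) 4a≤2δ)
      (solve 1 (λ δ → (δ :+ δ) :- (δ :+ (δ :+ (δ :+ (δ :+ con (+ 0))))) := con (+ 0) :- (δ :+ (δ :+ con (+ 0))))
        refl δ)))

  -- As `κ` is 1/4, the last hypothesis says that (q + 1)(4a)ᵈ < εᵈ. This gives both 4a ≤ ε and,
  -- since ε ≤ 1, the cost bound for 4a; δ is half the radius enclosing 4a.
  separatedRadius : ∀ q {a ε κ} → 0# ≤ a → 0# < ε → ε ≤ 1# → 0# < κ → 4 · κ ≈ 1# →
    suc q · (a ^ d) < (κ * ε) ^ d →
    ∃ λ δ → 0# < δ × a < δ × δ + δ ≤ ε × suc q · ((δ + δ) ^ d) ≤ ε
  separatedRadius q {a} {ε} {κ} 0≤a 0<ε ε≤1 0<κ 4κ≈1 qa^d< =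
    halve (enclosingRadius q 0≤4a ([1+n]·^-cancel-< q 0≤4a (<⇒≤ 0<ε) q[4a]^d<)
      (≤-trans (<⇒≤ q[4a]^d<) (x^[1+n]≤x e (<⇒≤ 0<ε) ε≤1)) 0<ε ε≤1)
    where
    0≤4a : 0# ≤ 4 · a
    0≤4a = ·-nonNeg 4 0≤a

    q[4a]^d< : suc q · ((4 · a) ^ d) < ε ^ d
    q[4a]^d< = ≰⇒> λ ε^d≤ → <⇒≱ qa^d< (begin
      (κ * ε) ^ d                      ≈⟨ ^-distrib-* κ ε d ⟩
      κ ^ d * ε ^ d                    ≤⟨ *-monoˡ-≤ (^-nonNeg d (<⇒≤ 0<κ)) ε^d≤ ⟩
      κ ^ d * suc q · ((4 · a) ^ d)    ≈⟨ ×-comm-* (suc q) (κ ^ d) ((4 · a) ^ d) ⟩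
      suc q · (κ ^ d * (4 · a) ^ d)    ≈⟨ ×-congʳ (suc q) (^-unscale 4 4κ≈1 d a) ⟩
      suc q · (a ^ d)                  ∎)

    halve : (∃ λ r → 0# < r × 4 · a ≤ r × r ≤ ε × suc q · (r ^ d) ≤ ε) →
      ∃ λ δ → 0# < δ × a < δ × δ + δ ≤ ε × suc q · ((δ + δ) ^ d) ≤ ε
    halve (r , 0<r , 4a≤r , r≤ε , qr^d≤ε) =
      let δ , 0<δ , δ+δ≈r = half 0<r in
      δ , 0<δ , 4a≤2δ⇒a<δ 0<δ (≤-respʳ-≈ (sym δ+δ≈r) 4a≤r) , ≤-respˡ-≈ (sym δ+δ≈r) r≤ε ,
      ≤-respˡ-≈ (×-congʳ (suc q) (^-congˡ d (sym δ+δ≈r))) qr^d≤ε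

  -- One step of the construction at scale `ε`: the denominator is `suc q`, and `δ` becomes the next
  -- scale.
  record Stage (x : ℝᵈ) (ε : ℝ) : Set where
    field
      q     : ℕ
      p     : Vector ℤ d
      δ     : ℝ
      0<δ   : 0# < δ
      close : ∀ i → ∣ suc q · x i - fromℤ (p i) ∣ ≤ δ
      small : δ + δ ≤ ε
      cheap : suc q · ((δ + δ) ^ d) ≤ ε

  WA⇒inf≤0 : ∀ {x} → x ∈ WA → inf (quality x) 1⁺ (0# , 0≤quality x) ≤ 0#
  WA⇒inf≤0 x∈WA = em⇒dne lem λ inf≰0 → x∈WA (≰⇒> inf≰0)

  ‖‖-approx : ∀ z {r} → ‖ z ‖ < r → ∃ λ m → distance z m < r
  ‖‖-approx z = inf-approx (distance z) (λ _ → + 0) (0# , 0≤distance z)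

  stageOfRadius : ∀ {x ε} n →
    (∃ λ δ → 0# < δ × ‖ n ·ᵛ x ‖ < δ × δ + δ ≤ ε × toℕ n · ((δ + δ) ^ d) ≤ ε) → Stage x ε
  stageOfRadius {x} {ε} n@(suc q , nz) (δ , 0<δ , a<δ , small , cheap) =
    approximate (‖‖-approx (n ·ᵛ x) a<δ)
    where
    approximate : (∃ λ p → distance (n ·ᵛ x) p < δ) → Stage x ε
    approximate (p , distance<δ) = record
      { q = q ; p = p ; δ = δ ; 0<δ = 0<δ ; small = small ; cheap = cheap
      ; close = λ i → ≤-trans (∣∣≤supNorm (n ·ᵛ x -ᵛ (λ j → fromℤ (p j))) i) (<⇒≤ distance<δ)
      }

  stageOfDenominator : ∀ {x ε κ} → 0# < ε → ε ≤ 1# → 0# < κ → 4 · κ ≈ 1# →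
    (∃ λ n → toℕ n · (‖ n ·ᵛ x ‖ ^ d) < (κ * ε) ^ d) → Stage x ε
  stageOfDenominator {x} 0<ε ε≤1 0<κ 4κ≈1 (n@(suc q , nz) , quality<) =
    stageOfRadius n (separatedRadius q {‖ n ·ᵛ x ‖} (0≤‖z‖ (n ·ᵛ x)) 0<ε ε≤1 0<κ 4κ≈1 quality<)

  WA⇒goodDenominator : ∀ {x} → x ∈ WA → ∀ {r} → 0# < r → ∃ λ n → quality x n < r
  WA⇒goodDenominator {x} x∈WA 0<r =
    inf-approx (quality x) 1⁺ (0# , 0≤quality x) (≤-<-trans (WA⇒inf≤0 {x} x∈WA) 0<r)

  stage : ∀ {x} → x ∈ WA → ∀ {ε} → 0# < ε → ε ≤ 1# → Stage x ε
  stage {x} x∈WA {ε} 0<ε ε≤1 =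
    let κ , 0<κ , 4κ≈1 = divide 3 0<1
        n , quality< = WA⇒goodDenominator {x} x∈WA (^-pos d (*-pos 0<κ 0<ε))
    in stageOfDenominator {κ = κ} 0<ε ε≤1 0<κ 4κ≈1 (n , quality<)

  -- The shift `y` built from a sequence of good denominators.

  module LimitPoint (x : ℝᵈ) (q : ℕ → ℕ) (p : ℕ → Vector ℤ d) (ε : ℕ → ℝ)
    (0<ε   : ∀ (j : ℕ) → 0# < ε j)
    (close : ∀ (j : ℕ) (i : Fin d) → ∣ suc (q j) · x i - fromℤ (p j i) ∣ ≤ ε (suc j))
    (small : ∀ (j : ℕ) → ε (suc j) + ε (suc j) ≤ ε j)
    (cheap : ∀ (j : ℕ) → suc (q j) · ((ε (suc j) + ε (suc j)) ^ d) ≤ ε j)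
    where

    n : ℕ → ℕ
    n zero    = 0
    n (suc j) = suc (q j) ℕ.+ n j

    j≤n : ∀ j → j ℕ.≤ n j
    j≤n zero    = z≤n
    j≤n (suc j) = s≤s (ℕ.≤-trans (j≤n j) (ℕ.m≤n+m (n j) (q j)))

    P : ℕ → Vector ℤ d
    P zero    i = + 0
    P (suc j) i = p j i ℤ.+ P j i

    -- A bound for the tail of the series defining the limit: its k-th term is at most `ε (suc k)`,
    -- and the scales at least halve.
    ρ : ℕ → ℝ
    ρ j = ε (suc j) + ε (suc j)

    0≤ρ : ∀ j → 0# ≤ ρ j
    0≤ρ j = +-nonNeg (<⇒≤ (0<ε (suc j))) (<⇒≤ (0<ε (suc j)))

    module _ (i : Fin d) where

      v : ℕ → ℝ
      v j = suc (q j) · x i - fromℤ (p j i)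

      center : ℕ → ℝ
      center j = n j · x i - fromℤ (P j i)

      center-suc : ∀ j → center (suc j) ≈ v j + center j
      center-suc j = begin-equality
        (suc (q j) ℕ.+ n j) · x i - fromℤ (p j i ℤ.+ P j i)
          ≈⟨ +-cong (×-homo-+ (x i) (suc (q j)) (n j)) (-‿cong (fromℤ-+ (p j i) (P j i))) ⟩
        (suc (q j) · x i + n j · x i) - (fromℤ (p j i) + fromℤ (P j i))
          ≈⟨ solve 4 (λ a b k l → (a :+ b) :- (k :+ l) := (a :- k) :+ (b :- l)) refl
               (suc (q j) · x i) (n j · x i) (fromℤ (p j i)) (fromℤ (P j i)) ⟩
        v j + center j ∎

      -- The intervals are nested: the center moves by at most `ε (suc j)`, and `ρ (suc j)` is at
      -- most `ε (suc j)`, which together make up `ρ j`.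
      limit : ∃ λ l → ∀ j → center j - ρ j ≤ l × l ≤ center j + ρ j
      limit = nestedIntervals (λ j → center j - ρ j) (λ j → center j + ρ j) lower↑ upper↓ lower≤upper
        where
        lower↑ : Nondecreasing (λ j → center j - ρ j)
        lower↑ j = begin
          center j - ρ j
            ≤⟨ ≤-by-difference (+-mono-≤ (≤-trans (-x≤∣x∣ (v j)) (close j i)) (small (suc j)))
                 (solve 4 (λ v c ε ρ → (ε :+ ε) :- (:- v :+ ρ) := ((v :+ c) :- ρ) :- (c :- (ε :+ ε))) refl
                   (v j) (center j) (ε (suc j)) (ρ (suc j))) ⟩
          v j + center j - ρ (suc j)
            ≈⟨ +-congʳ (center-suc j) ⟨
          center (suc j) - ρ (suc j)
            ∎

        upper↓ : ∀ j → center (suc j) + ρ (suc j) ≤ center j + ρ j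
        upper↓ j = begin
          center (suc j) + ρ (suc j)
            ≈⟨ +-congʳ (center-suc j) ⟩
          v j + center j + ρ (suc j)
            ≤⟨ ≤-by-difference (+-mono-≤ (≤-trans (x≤∣x∣ (v j)) (close j i)) (small (suc j)))
                 (solve 4 (λ v c ε ρ → (ε :+ ε) :- (v :+ ρ) := (c :+ (ε :+ ε)) :- ((v :+ c) :+ ρ)) refl
                   (v j) (center j) (ε (suc j)) (ρ (suc j))) ⟩
          center j + ρ j
            ∎

        lower≤upper : ∀ j → center j - ρ j ≤ center j + ρ j
        lower≤upper j = ≤-by-difference (+-nonNeg (0≤ρ j) (0≤ρ j))
          (solve 2 (λ c ρ → (ρ :+ ρ) :- con (+ 0) := (c :+ ρ) :- (c :- ρ)) refl (center j) (ρ j))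

    y : ℝᵈ
    y i = - proj₁ (limit i)

    -- The lattice point `P (suc j)` leaves the center minus the limit in each coordinate. The index
    -- is shifted because `n 0` is not positive.
    approach : ∀ j → ‖ (n (suc j) , _) ·ᵛ x +ᵛ y ‖ ≤ ρ (suc j)
    approach j = ≤-trans (‖‖≤distance ((n (suc j) , _) ·ᵛ x +ᵛ y) (P (suc j)))
      (supNorm-lub (((n (suc j) , _) ·ᵛ x +ᵛ y) -ᵛ (λ i → fromℤ (P (suc j) i))) (0≤ρ (suc j)) λ i →
        let l = proj₁ (limit i) ; bounds = proj₂ (limit i) (suc j) in
        ⊔-lub
          (≤-by-difference (proj₁ bounds)
            (solve 4 (λ b k l ρ → l :- ((b :- k) :- ρ) := ρ :- ((b :+ :- l) :- k)) refl
              (n (suc j) · x i) (fromℤ (P (suc j) i)) l (ρ (suc j))))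
          (≤-by-difference (proj₂ bounds)
            (solve 4 (λ b k l ρ → ((b :- k) :+ ρ) :- l := ρ :- :- ((b :+ :- l) :- k)) refl
              (n (suc j) · x i) (fromℤ (P (suc j) i)) l (ρ (suc j)))))

    module _ {ψ : ℕ⁺ → ℝ} (ψ∈𝒟 : 𝒟 ψ) (N : ℕ)
      (missed : ∀ (m : ℕ⁺) → N ℕ.≤ toℕ m → ψ m ≤ ‖ m ·ᵛ x +ᵛ y ‖) where

      open 𝒟 ψ∈𝒟

      s : ℕ → ℝ
      s = partialSum (λ m → ψ m ^ d)

      s↑ : Nondecreasing s
      s↑ k = begin
        s k                      ≈⟨ +-identityʳ (s k) ⟨
        s k + 0#                 ≤⟨ +-monoʳ-≤ (s k) (^-nonNeg d (nonNegative (suc k , _))) ⟩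
        s (suc k)                ∎

      -- Monotonicity of `ψ` carries the bound at time `n (suc j)` over the following
      -- `suc (q (suc j))` terms, whose total `cheap` controls.
      block : ∀ j → N ℕ.≤ j → s (n (suc (suc j))) ≤ s (n (suc j)) + ε (suc j)
      block j N≤j = begin
        s (n (suc (suc j)))                                    ≤⟨ partialSum-upper (λ m → ψ m ^ d) ψ≤ρ (suc (q (suc j))) ⟩
        s (n (suc j)) + suc (q (suc j)) · (ρ (suc j) ^ d)      ≤⟨ +-monoʳ-≤ (s (n (suc j))) (cheap (suc j)) ⟩
        s (n (suc j)) + ε (suc j)                              ∎
        where
        ψ≤ρ : ∀ k → n (suc j) ℕ.≤ k → ψ (suc k , _) ^ d ≤ ρ (suc j) ^ d
        ψ≤ρ k n≤k = ^-mono-≤ d (nonNegative (suc k , _)) (begin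
          ψ (suc k , _)                            ≤⟨ nonIncreasing (n (suc j) , _) (suc k , _) (ℕ.m≤n⇒m≤1+n n≤k) ⟩
          ψ (n (suc j) , _)                        ≤⟨ missed (n (suc j) , _) (ℕ.≤-trans (ℕ.m≤n⇒m≤1+n N≤j) (j≤n (suc j))) ⟩
          ‖ (n (suc j) , _) ·ᵛ x +ᵛ y ‖            ≤⟨ approach j ⟩
          ρ (suc j)                                ∎)

      -- Since ε j ≤ 2 ε j − 2 ε (j + 1), the bounds on the blocks telescope.
      potential : ℕ → ℝ
      potential j = s (n (suc j)) + (ε (suc j) + ε (suc j))

      potential↓ : ∀ j → N ℕ.≤ j → potential (suc j) ≤ potential j
      potential↓ j N≤j = begin
        potential (suc j)                                      ≤⟨ +-mono-≤ (block j N≤j) (small (suc j)) ⟩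
        s (n (suc j)) + ε (suc j) + ε (suc j)                  ≈⟨ +-assoc _ _ _ ⟩
        potential j                                            ∎

      potential-bounded : ∀ k → potential (k ℕ.+ N) ≤ potential N
      potential-bounded zero    = ≤-refl
      potential-bounded (suc k) = ≤-trans (potential↓ (k ℕ.+ N) (ℕ.m≤n+m N k)) (potential-bounded k)

      s-bounded : ∀ k → s k ≤ potential N
      s-bounded k = begin
        s k                          ≤⟨ nondecreasing-≤ s↑ (ℕ.≤-trans (ℕ.m≤n⇒m≤1+n (ℕ.m≤m+n k N)) (j≤n (suc (k ℕ.+ N)))) ⟩
        s (n (suc (k ℕ.+ N)))        ≈⟨ +-identityʳ _ ⟨
        s (n (suc (k ℕ.+ N))) + 0#   ≤⟨ +-monoʳ-≤ _ (0≤ρ (k ℕ.+ N)) ⟩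
        potential (k ℕ.+ N)          ≤⟨ potential-bounded k ⟩
        potential N                  ∎

      contradiction : ⊥
      contradiction = divergent (boundedMonotone⇒converges s s↑ (potential N) s-bounded)

    y∈Π : (x , y) ∈ Π
    y∈Π (ψ , ψ∈𝒟) N = em⇒dne lem λ none → contradiction ψ∈𝒟 N λ m N≤m →
      em⇒dne lem λ ψ≰ → none (m , N≤m , ≰⇒> ψ≰)

  -- The two inclusions.

  WA⊆π[Π] : ∀ {x} → x ∈ WA → x ∈ π[ Π ]
  WA⊆π[Π] {x} x∈WA = (x , y) , y∈Π , λ _ → refl
    where
    -- Dependent choice by mutual recursion: each scale after the first is the `δ` of the preceding
    -- stage.
    scale : ℕ → ∃ λ ε → 0# < ε × ε ≤ 1#
    stages : ∀ j → Stage x (proj₁ (scale j))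

    scale zero    = 1# , 0<1 , ≤-refl
    scale (suc j) = δ , 0<δ , (begin
      δ                   ≈⟨ +-identityʳ δ ⟨
      δ + 0#              ≤⟨ +-monoʳ-≤ δ (<⇒≤ 0<δ) ⟩
      δ + δ               ≤⟨ small ⟩
      proj₁ (scale j)     ≤⟨ proj₂ (proj₂ (scale j)) ⟩
      1#                  ∎)
      where open Stage (stages j)

    stages j = stage {x} x∈WA (proj₁ (proj₂ (scale j))) (proj₂ (proj₂ (scale j)))

    open LimitPoint x (λ j → Stage.q (stages j)) (λ j → Stage.p (stages j)) (λ j → proj₁ (scale j))
      (λ j → proj₁ (proj₂ (scale j))) (λ j → Stage.close (stages j))
      (λ j → Stage.small (stages j)) (λ j → Stage.cheap (stages j))

  π[Π]⊆WA : ∀ {x} → x ∈ π[ Π ] → x ∈ WA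
  π[Π]⊆WA {x} ((x₀ , y) , x₀y∈Π , x₀≋x) x∈Bad = notInΠ {x} x∈Bad {x₀} x₀≋x y x₀y∈Π

theorem1 : ExcludedMiddle 0ℓ → (R : CompleteOrderedField) (d : ℕ) .{{_ : NonZero d}} →
    let open DiophantineApproximation R d in
    (WA ≐ π[ Π ]) × (Bad ≐ ∁ π[ Π ])
theorem1 lem R (suc e) =
  ((λ {x} → WA⊆π[Π] {x}) , (λ {x} → π[Π]⊆WA {x})) ,
  (λ {x} x∈Bad x∈π[Π] → π[Π]⊆WA {x} x∈π[Π] x∈Bad) ,
  (λ {x} x∉π[Π] → em⇒dne lem λ x∈WA → x∉π[Π] (WA⊆π[Π] {x} x∈WA))
  where open Approximation lem R e
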